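{- Let $r,m\in\mathbb{N}$, and let $f,g:\mathbb{N}^m\to\mathbb{N}$ be two polynomials of finite degree with no constant term such that $f\approx g$. If $\mathbb{N}=\bigcup_{i=1}^rA_i$ is any $r$-coloring, then there are two sequences $\langle x_n\rangle_{n=1}^\infty$ and $\langle y_n\rangle_{n=1}^\infty$ in $\mathbb{N}$ and $i\in\{1,\ldots,r\}$ such that $$MT(f,\langle x_n\rangle_{n=1}^\infty)\cup MT(g,\langle y_n\rangle_{n=1}^\infty)\subseteq A_i.$$
   Context: $\mathbb{N}$ is the set of positive integers. An $r$-coloring of $\mathbb{N}$ is a partition of $\mathbb{N}$ into $r$ disjoint subsets. For nonempty finite $\beta,\gamma\subseteq\mathbb{N}$, $\beta<\gamma$ means $\max\beta<\min\gamma$. Equivalence of polynomials: for polynomials $f,g:\mathbb{N}^m\to\mathbb{N}$ written $f(x_1,\ldots,x_m)=\sum a_{i_1\cdots i_m}x_1^{i_1}\cdots x_m^{i_m}$ and $g(x_1,\ldots,x_m)=\sum b_{i_1\cdots i_m}x_1^{i_1}\cdots x_m^{i_m}$, one writes $f\approx g$ iff $f$ and $g$ have the same degree and there exists a rational $\alpha\in\mathbb{Q}$ such that $b_{i_1\cdots i_m}=\alpha^{i_1+\cdots+i_m}a_{i_1\cdots i_m}$ for all $(i_1,\ldots,i_m)$. Polynomial Milliken–Taylor system: for a polynomial $f:\mathbb{N}^m\to\mathbb{N}$ with no constant term and a sequence $\langle x_n\rangle_{n=1}^\infty$ in $\mathbb{N}$, $$MT(f,\langle x_n\rangle_{n=1}^\infty)=\left\{f\Bigl(\sum_{i\in\beta_1}x_i,\ldots,\sum_{i\in\beta_m}x_i\Bigr):\beta_1<\cdots<\beta_m\text{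 nonempty finite subsets of }\mathbb{N}\right\}.$$
   Formalization: Added hypothesis: corresponding coefficients of f and g never have opposite signs (automatic if coefficients are nonnegative or α > 0). Without it the claim fails: f = 2x²−x, g = 2x²+x, α = −1 have disjoint ranges. -}

module Defs where

import Algebra.Definitions.RawSemiring
open import Data.Fin.Base using (Fin)
open import Data.Integer.Base using (+_)
open import Data.List.Base as List using (List; upTo; cartesianProductWith)
open import Data.List.NonEmpty.Base as List⁺ using (List⁺)
import Data.List.Relation.Unary.Linked as ListLinked
open import Data.Nat.Base as ℕ using (ℕ; zero; suc; _⊔_; _⊓_)
open import Data.Nat.ListAction using (sum)
open import Data.Product using (∃; ∃!; _×_)
open import Data.Rational.Base as ℚ using (ℚ; 0ℚ; _/_)
open import Data.Vec.Base as Vec using (Vec; []; _∷_)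
open import Data.Vec.Relation.Unary.All using (All)
import Data.Vec.Relation.Unary.Linked as VecLinked
open import Function.Bundles using (_⇔_)
open import Level using (0ℓ)
open import Relation.Binary.PropositionalEquality using (_≡_; _≢_)
open import Relation.Unary using (Pred; _∈_)

module ℚ^ = Algebra.Definitions.RawSemiring ℚ.+-*-rawSemiring

-- Mathematically ℕ means {1, 2, 3, …} here, i.e. the set of n : ℕ with 0 < n,
-- and the condition is written out wherever numbers are arguments, values or
-- terms of a sequence.  Index sets start at 0 instead of 1; this is only a
-- relabelling.

fromℕ : ℕ → ℚ
fromℕ n = + n / 1

-- An r-colouring of the positive integers; nothing is said about 0.
IsColoring : ∀ {r} → (Fin r → Pred ℕ 0ℓ) → Set
IsColoring A = ∀ n → 0 ℕ.< n → ∃! _≡_ (λ i → n ∈ A i)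

------------------------------------------------------------------------
-- Polynomials

Exponent : ℕ → Set
Exponent m = Vec ℕ m

∣_∣ : ∀ {m} → Exponent m → ℕ
∣ e ∣ = Vec.sum e

-- Rational coefficients are the most general ones for a polynomial taking
-- natural values at all positive integer points (consider x (x + 1) / 2).
-- The field bound is any upper bound for the degree, not the degree itself.
record Polynomial (m : ℕ) : Set where
  field
    coeff    : Exponent m → ℚ
    bound    : ℕ
    vanishes : ∀ e → bound ℕ.< ∣ e ∣ → coeff e ≡ 0ℚ

open Polynomial public

monomial : ∀ {m} → Exponent m → Vec ℕ m → ℕ
monomial e x = Vec.foldr′ ℕ._*_ 1 (Vec.zipWith ℕ._^_ x e)

-- All exponents with every entry at most d, each listed once.
exponents : ∀ m → ℕ → List (Exponent m)
exponents zero    d = List.[ [] ]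
exponents (suc m) d = cartesianProductWith _∷_ (upTo (suc d)) (exponents m d)

eval : ∀ {m} → Polynomial m → Vec ℕ m → ℚ
eval {m} f x =
  List.foldr ℚ._+_ 0ℚ
    (List.map (λ e → coeff f e ℚ.* fromℕ (monomial e x)) (exponents m (bound f)))

MapsPositivesToPositives : ∀ {m} → Polynomial m → Set
MapsPositivesToPositives f =
  ∀ x → All (0 ℕ.<_) x → ∃ λ k → 0 ℕ.< k × eval f x ≡ fromℕ k

NoConstantTerm : ∀ {m} → Polynomial m → Set
NoConstantTerm f = coeff f (Vec.replicate _ 0) ≡ 0ℚ

HasDegree : ∀ {m} → Polynomial m → ℕ → Set
HasDegree f d =
  (∃ λ e → ∣ e ∣ ≡ d × coeff f e ≢ 0ℚ) × (∀ e → d ℕ.< ∣ e ∣ → coeff f e ≡ 0ℚ)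

infix 4 _≈_

_≈_ : ∀ {m} → Polynomial m → Polynomial m → Set
f ≈ g =
  (∀ d → HasDegree f d ⇔ HasDegree g d) ×
  (∃ λ (α : ℚ) → ∀ e → coeff g e ≡ (α ℚ^.^ ∣ e ∣) ℚ.* coeff f e)

-- Corresponding coefficients never have opposite signs.  This holds whenever
-- the coefficients are nonnegative, and also whenever f ≈ g by some α > 0; it
-- only excludes a negative α that really changes a sign.  Such an α makes the
-- theorem false: f = 2x² - x and g = 2x² + x satisfy f ≈ g with α = -1, but
-- f(n) and g(n) are the triangular numbers of index 2n - 1 and 2n, so a
-- 2-colouring separates all values of f from all values of g.
NoOppositeSigns : ∀ {m} → Polynomial m → Polynomial m → Set
NoOppositeSigns f g = ∀ e → 0ℚ ℚ.≤ coeff f e ℚ.* coeff g e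

------------------------------------------------------------------------
-- Milliken–Taylor systems

-- A nonempty finite subset of ℕ, as the increasing list of its elements.
record FiniteSubset⁺ : Set where
  field
    elements   : List⁺ ℕ
    increasing : ListLinked.Linked ℕ._<_ (List⁺.toList elements)

open FiniteSubset⁺ public

max min : FiniteSubset⁺ → ℕ
max β = List⁺.foldr₁ _⊔_ (elements β)
min β = List⁺.foldr₁ _⊓_ (elements β)

infix 4 _≺_

_≺_ : FiniteSubset⁺ → FiniteSubset⁺ → Set
β ≺ γ = max β ℕ.< min γ

sumOver : (ℕ → ℕ) → FiniteSubset⁺ → ℕ
sumOver x β = sum (List.map x (List⁺.toList (elements β)))

MT : ∀ {m} → Polynomial m → (ℕ → ℕ) → Pred ℕ 0ℓ
MT {m} f x k =
  ∃ λ (β : Vec FiniteSubset⁺ m) →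
    VecLinked.Linked _≺_ β × fromℕ k ≡ eval f (Vec.map (sumOver x) β)

{-# OPTIONS --safe #-}

-- NoOppositeSigns lets α be replaced by |α| = p / q with p, q > 0, and then
-- g (q z) = f (p z).  So x = p z and y = q z will do, where z makes the colour of
-- f (p a₁, …, p aₘ) the same for all tuples of sums a₁, …, aₘ of z over increasing
-- blocks; such a z is provided by the Milliken–Taylor theorem.  The latter is
-- Hindman's theorem combined with a diagonal argument: by induction on m, the
-- colour of (a, a₂, …, aₘ) can be made to depend on a alone.  Hindman's theorem
-- itself follows Baumgartner: some colour class X is large, i.e. meets the set
-- of finite sums of every sequence refining a given one, and for a large X there
-- is an e in X such that X ∩ (X - e) is again large for a refinement.
module Submission where

open import Defs
open import Algebra.Bundles using (module CommutativeMonoid)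
open import Axiom.ExcludedMiddle using (ExcludedMiddle)
open import Data.Empty using (⊥-elim)
open import Data.Fin.Base using (Fin)
import Data.Integer.Base as ℤ
import Data.Integer.Properties as ℤ
open import Data.List.Base as List using (List; []; _∷_; _++_; upTo; cartesianProductWith)
open import Data.List.Membership.Propositional using (_∈_; lose)
open import Data.List.Membership.Propositional.Properties using (∈-++⁺ˡ; ∈-++⁺ʳ; ∈-map⁺; ∈-allFin)
open import Data.List.NonEmpty.Base as List⁺ using (List⁺; _∷_)
import Data.List.Properties as List
open import Data.List.Relation.Unary.All as All using (All; []; _∷_)
import Data.List.Relation.Unary.All.Properties as All
open import Data.List.Relation.Unary.Any as Any using (Any; here; there)
open import Data.List.Relation.Unary.Linked as Linked using (Linked; [-]; _∷_)
open import Data.Nat.Base as ℕ using (ℕ; zero; suc; pred; _+_; _*_; _^_; _⊔_; _≤_; _<_; z≤n; s≤s;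
  _≤′_; ≤′-refl; ≤′-step; NonZero; >-nonZero)
open import Data.Nat.ListAction using (sum)
open import Data.Nat.Properties
open import Data.Product using (∃; ∃₂; _×_; _,_; proj₁; proj₂)
open import Data.Rational.Base as ℚ using (ℚ; mkℚ; 0ℚ; toℚᵘ; ↥_; ↧ₙ_)
import Data.Rational.Properties as ℚ
import Data.Rational.Unnormalised.Base as ℚᵘ
import Data.Rational.Unnormalised.Properties as ℚᵘ
open import Data.Sum.Base using (inj₁; inj₂)
open import Data.Vec.Base as Vec using (Vec; []; _∷_)
import Data.Vec.Properties as Vec
open import Data.Vec.Relation.Unary.All as VecAll using ([]; _∷_)
open import Data.Vec.Relation.Unary.Linked as VecLinked using ([]; [-]; _∷_)
open import Function.Base using (_∘_; id)
open import Level using (0ℓ)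
open import Relation.Binary.Definitions using (tri<; tri≈; tri>)
open import Relation.Binary.PropositionalEquality
open import Relation.Nullary using (¬_; yes; no; contradiction)
open import Relation.Unary using (Pred; _∪_; _⊆_)

open import Algebra.Properties.CommutativeSemigroup
  (CommutativeMonoid.commutativeSemigroup ℚ.*-1-commutativeMonoid) using (interchange; x∙yz≈y∙xz)
open import Algebra.Properties.Group ℚ.+-0-group using (⁻¹-involutive)

-- Rescaling the arguments of a polynomial

toℚᵘ-fromℕ : ∀ n → toℚᵘ (fromℕ n) ℚᵘ.≃ ℚᵘ.mkℚᵘ (ℤ.+ n) 0
toℚᵘ-fromℕ n = ℚ.toℚᵘ-fromℚᵘ (ℚᵘ.mkℚᵘ (ℤ.+ n) 0)

fromℕ-injective : ∀ {a b} → fromℕ a ≡ fromℕ b → a ≡ b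
fromℕ-injective {a} {b} eq
  with ℚᵘ.*≡* e ← ℚᵘ.≃-trans (ℚᵘ.≃-sym (toℚᵘ-fromℕ a)) (ℚᵘ.≃-trans (ℚ.toℚᵘ-cong eq) (toℚᵘ-fromℕ b))
  = ℤ.+-injective (trans (sym (ℤ.*-identityʳ (ℤ.+ a))) (trans e (ℤ.*-identityʳ (ℤ.+ b))))

toℚᵘ-*-fromℕ : ∀ p b → toℚᵘ (p ℚ.* fromℕ b) ℚᵘ.≃ toℚᵘ p ℚᵘ.* ℚᵘ.mkℚᵘ (ℤ.+ b) 0
toℚᵘ-*-fromℕ p b = ℚᵘ.≃-trans (ℚ.toℚᵘ-homo-* p (fromℕ b)) (ℚᵘ.*-congˡ {toℚᵘ p} (toℚᵘ-fromℕ b))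

fromℕ-* : ∀ a b → fromℕ (a * b) ≡ fromℕ a ℚ.* fromℕ b
fromℕ-* a b = ℚ.toℚᵘ-injective (begin
  toℚᵘ (fromℕ (a * b))
    ≈⟨ toℚᵘ-fromℕ (a * b) ⟩
  ℚᵘ.mkℚᵘ (ℤ.+ (a * b)) 0
    ≡⟨ cong (λ n → ℚᵘ.mkℚᵘ n 0) (ℤ.pos-* a b) ⟩
  ℚᵘ.mkℚᵘ (ℤ.+ a) 0 ℚᵘ.* ℚᵘ.mkℚᵘ (ℤ.+ b) 0
    ≈⟨ ℚᵘ.*-congʳ {ℚᵘ.mkℚᵘ (ℤ.+ b) 0} (toℚᵘ-fromℕ a) ⟨
  toℚᵘ (fromℕ a) ℚᵘ.* ℚᵘ.mkℚᵘ (ℤ.+ b) 0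
    ≈⟨ toℚᵘ-*-fromℕ (fromℕ a) b ⟨
  toℚᵘ (fromℕ a ℚ.* fromℕ b)
    ∎)
  where open ℚᵘ.≃-Reasoning

∣p∣*↧p : ∀ p → ℚ.∣ p ∣ ℚ.* fromℕ (↧ₙ p) ≡ fromℕ ℤ.∣ ↥ p ∣
∣p∣*↧p p@(mkℚ n d _) = ℚ.toℚᵘ-injective (begin
  toℚᵘ (ℚ.∣ p ∣ ℚ.* fromℕ (suc d))
    ≈⟨ toℚᵘ-*-fromℕ ℚ.∣ p ∣ (suc d) ⟩
  ℚᵘ.mkℚᵘ (ℤ.+ ℤ.∣ n ∣) d ℚᵘ.* ℚᵘ.mkℚᵘ (ℤ.+ suc d) 0
    ≈⟨ ℚᵘ.*≡* (trans (ℤ.*-identityʳ (ℤ.+ ℤ.∣ n ∣ ℤ.* ℤ.+ suc d))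
                     (cong (λ k → ℤ.+ ℤ.∣ n ∣ ℤ.* ℤ.+ k) (sym (*-identityʳ (suc d))))) ⟩
  ℚᵘ.mkℚᵘ (ℤ.+ ℤ.∣ n ∣) 0
    ≈⟨ toℚᵘ-fromℕ ℤ.∣ n ∣ ⟨
  toℚᵘ (fromℕ ℤ.∣ n ∣)
    ∎)
  where open ℚᵘ.≃-Reasoning

∣p^n∣ : ∀ p n → ℚ.∣ p ℚ^.^ n ∣ ≡ ℚ.∣ p ∣ ℚ^.^ n
∣p^n∣ p zero = refl
∣p^n∣ p (suc n) = trans (ℚ.∣p*q∣≡∣p∣*∣q∣ p _) (cong (ℚ.∣ p ∣ ℚ.*_) (∣p^n∣ p n))

∣p∣^n*↧p^n : ∀ p n → ℚ.∣ p ∣ ℚ^.^ n ℚ.* fromℕ (↧ₙ p ^ n) ≡ fromℕ (ℤ.∣ ↥ p ∣ ^ n)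
∣p∣^n*↧p^n p zero = refl
∣p∣^n*↧p^n p (suc n) = begin
  (ℚ.∣ p ∣ ℚ.* r) ℚ.* fromℕ (↧ₙ p * b)           ≡⟨ cong ((ℚ.∣ p ∣ ℚ.* r) ℚ.*_) (fromℕ-* (↧ₙ p) b) ⟩
  (ℚ.∣ p ∣ ℚ.* r) ℚ.* (fromℕ (↧ₙ p) ℚ.* fromℕ b) ≡⟨ interchange ℚ.∣ p ∣ r _ _ ⟩
  (ℚ.∣ p ∣ ℚ.* fromℕ (↧ₙ p)) ℚ.* (r ℚ.* fromℕ b) ≡⟨ cong₂ ℚ._*_ (∣p∣*↧p p) (∣p∣^n*↧p^n p n) ⟩
  fromℕ ℤ.∣ ↥ p ∣ ℚ.* fromℕ (ℤ.∣ ↥ p ∣ ^ n)      ≡⟨ fromℕ-* ℤ.∣ ↥ p ∣ _ ⟨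
  fromℕ (ℤ.∣ ↥ p ∣ * ℤ.∣ ↥ p ∣ ^ n)              ∎
  where
  open ≡-Reasoning
  r = ℚ.∣ p ∣ ℚ^.^ n
  b = ↧ₙ p ^ n

p*p≤0⇒p≡0 : ∀ p → p ℚ.* p ℚ.≤ 0ℚ → p ≡ 0ℚ
p*p≤0⇒p≡0 p p²≤0 with ℚ.<-cmp p 0ℚ
... | tri≈ _ p≡0 _ = p≡0
... | tri< p<0 _ _ =
  contradiction (ℚ.<-≤-trans (ℚ.positive⁻¹ _ {{ℚ.neg*neg⇒pos p p}}) p²≤0) (ℚ.<-irrefl refl)
  where instance _ = ℚ.negative p<0
... | tri> _ _ p>0 =
  contradiction (ℚ.<-≤-trans (ℚ.positive⁻¹ _ {{ℚ.pos*pos⇒pos p p}}) p²≤0) (ℚ.<-irrefl refl)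
  where instance _ = ℚ.positive p>0

-- If `∣ s ∣` is `- s`, multiplying the hypothesis by `∣ s ∣` gives `0 ≤ - t²` for `t = s a`, so `t`
-- vanishes and its sign does not matter.
0≤a*sa⇒sa≡∣s∣a : ∀ s a → 0ℚ ℚ.≤ a ℚ.* (s ℚ.* a) → s ℚ.* a ≡ ℚ.∣ s ∣ ℚ.* a
0≤a*sa⇒sa≡∣s∣a s a 0≤a*sa with ℚ.∣p∣≡p∨∣p∣≡-p s
... | inj₁ ∣s∣≡s = cong (ℚ._* a) (sym ∣s∣≡s)
... | inj₂ ∣s∣≡-s = begin
    t                 ≡⟨ t≡0 ⟩
    ℚ.- 0ℚ            ≡⟨ cong ℚ.-_ t≡0 ⟨
    ℚ.- t             ≡⟨ ℚ.neg-distribˡ-* s a ⟩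
    ℚ.- s ℚ.* a       ≡⟨ cong (ℚ._* a) ∣s∣≡-s ⟨
    ℚ.∣ s ∣ ℚ.* a     ∎
    where
    open ≡-Reasoning
    t = s ℚ.* a
    0≤-t² : 0ℚ ℚ.≤ ℚ.- (t ℚ.* t)
    0≤-t² = subst (0ℚ ℚ.≤_) (begin
        ℚ.∣ s ∣ ℚ.* (a ℚ.* t)  ≡⟨ ℚ.*-assoc ℚ.∣ s ∣ a t ⟨
        ℚ.∣ s ∣ ℚ.* a ℚ.* t    ≡⟨ cong (λ u → u ℚ.* a ℚ.* t) ∣s∣≡-s ⟩
        ℚ.- s ℚ.* a ℚ.* t      ≡⟨ cong (ℚ._* t) (ℚ.neg-distribˡ-* s a) ⟨
        ℚ.- t ℚ.* t            ≡⟨ ℚ.neg-distribˡ-* t t ⟨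
        ℚ.- (t ℚ.* t)          ∎)
      (ℚ.nonNegative⁻¹ _ {{ℚ.nonNeg*nonNeg⇒nonNeg
        ℚ.∣ s ∣ {{ℚ.∣-∣-nonNeg s}} (a ℚ.* t) {{ℚ.nonNegative 0≤a*sa}}}})
    t≡0 : t ≡ 0ℚ
    t≡0 = p*p≤0⇒p≡0 t (subst (ℚ._≤ 0ℚ) (⁻¹-involutive (t ℚ.* t)) (ℚ.neg-antimono-≤ 0≤-t²))

sumMap : {I : Set} → (I → ℚ) → List I → ℚ
sumMap F is = List.foldr ℚ._+_ 0ℚ (List.map F is)

sumMap-cong : ∀ {I : Set} {F G : I → ℚ} → (∀ i → F i ≡ G i) → ∀ is → sumMap F is ≡ sumMap G is
sumMap-cong F≡G is = cong (List.foldr ℚ._+_ 0ℚ) (List.map-cong F≡G is)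

sumMap-0 : ∀ {I : Set} {F : I → ℚ} → (∀ i → F i ≡ 0ℚ) → ∀ is → sumMap F is ≡ 0ℚ
sumMap-0 F≡0 [] = refl
sumMap-0 F≡0 (i ∷ is) = cong₂ ℚ._+_ (F≡0 i) (sumMap-0 F≡0 is)

sumMap-++ : ∀ {I : Set} (F : I → ℚ) is js → sumMap F (is ++ js) ≡ sumMap F is ℚ.+ sumMap F js
sumMap-++ F [] js = sym (ℚ.+-identityˡ _)
sumMap-++ F (i ∷ is) js = trans (cong (F i ℚ.+_) (sumMap-++ F is js)) (sym (ℚ.+-assoc (F i) _ _))

sumMap-cartesianProduct : ∀ {I J K : Set} (f : I → J → K) (F : K → ℚ) is js →
  sumMap F (cartesianProductWith f is js) ≡ sumMap (λ i → sumMap (F ∘ f i) js) is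
sumMap-cartesianProduct f F [] js = refl
sumMap-cartesianProduct f F (i ∷ is) js =
  trans (sumMap-++ F (List.map (f i) js) _)
        (cong₂ ℚ._+_ (cong (List.foldr ℚ._+_ 0ℚ) (sym (List.map-∘ js)))
                     (sumMap-cartesianProduct f F is js))

sumMap-upTo-suc : (F : ℕ → ℚ) → ∀ {n} → F n ≡ 0ℚ → sumMap F (upTo (suc n)) ≡ sumMap F (upTo n)
sumMap-upTo-suc F {n} Fn≡0 = begin
  sumMap F (upTo (suc n))               ≡⟨ cong (sumMap F) (List.upTo-∷ʳ n) ⟨
  sumMap F (upTo n ++ n ∷ [])           ≡⟨ sumMap-++ F (upTo n) (n ∷ []) ⟩
  sumMap F (upTo n) ℚ.+ (F n ℚ.+ 0ℚ)    ≡⟨ cong (λ p → sumMap F (upTo n) ℚ.+ (p ℚ.+ 0ℚ)) Fn≡0 ⟩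
  sumMap F (upTo n) ℚ.+ 0ℚ              ≡⟨ ℚ.+-identityʳ _ ⟩
  sumMap F (upTo n)                     ∎
  where open ≡-Reasoning

-- Makes `eval` independent of the chosen degree bound. Raising the bound adds a row with first
-- exponent `suc d`, which vanishes for reasons of degree; the other rows reduce to the bound `c` by
-- induction on `m`.
sumMap-exponents : ∀ {m} (F : Exponent m → ℚ) {c d} → (∀ e → c < ∣ e ∣ → F e ≡ 0ℚ) → c ≤′ d →
  sumMap F (exponents m d) ≡ sumMap F (exponents m c)
sumMap-exponents F F≡0 ≤′-refl = refl
sumMap-exponents {zero} F F≡0 (≤′-step c≤d) = refl
sumMap-exponents {suc m} F {c} {suc d} F≡0 (≤′-step c≤d) = begin
  sumMap F (exponents (suc m) (suc d))
    ≡⟨ sumMap-cartesianProduct _∷_ F (upTo (2 + d)) (exponents m (suc d)) ⟩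
  sumMap (λ i → sumMap (F ∘ (i ∷_)) (exponents m (suc d))) (upTo (2 + d))
    ≡⟨ sumMap-upTo-suc (λ i → sumMap (F ∘ (i ∷_)) (exponents m (suc d))) lastRow≡0 ⟩
  sumMap (λ i → sumMap (F ∘ (i ∷_)) (exponents m (suc d))) (upTo (suc d))
    ≡⟨ sumMap-cong row (upTo (suc d)) ⟩
  sumMap (λ i → sumMap (F ∘ (i ∷_)) (exponents m d)) (upTo (suc d))
    ≡⟨ sumMap-cartesianProduct _∷_ F (upTo (suc d)) (exponents m d) ⟨
  sumMap F (exponents (suc m) d)
    ≡⟨ sumMap-exponents F F≡0 c≤d ⟩
  sumMap F (exponents (suc m) c)
    ∎
  where
  open ≡-Reasoning
  F∷≡0 : ∀ i e → c < ∣ e ∣ → F (i ∷ e) ≡ 0ℚ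
  F∷≡0 i e c<e = F≡0 (i ∷ e) (≤-trans c<e (m≤n+m _ i))

  lastRow≡0 : sumMap (F ∘ (suc d ∷_)) (exponents m (suc d)) ≡ 0ℚ
  lastRow≡0 = sumMap-0
    (λ e → F≡0 (suc d ∷ e) (s≤s (≤-trans (≤′⇒≤ c≤d) (m≤m+n d _)))) (exponents m (suc d))

  row : ∀ i → sumMap (F ∘ (i ∷_)) (exponents m (suc d)) ≡ sumMap (F ∘ (i ∷_)) (exponents m d)
  row i = trans (sumMap-exponents (F ∘ (i ∷_)) (F∷≡0 i) (≤′-step c≤d))
                (sym (sumMap-exponents (F ∘ (i ∷_)) (F∷≡0 i) c≤d))

term : ∀ {m} → Polynomial m → Vec ℕ m → Exponent m → ℚ
term f x e = coeff f e ℚ.* fromℕ (monomial e x)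

eval≡sumMap : ∀ {m} (f : Polynomial m) x {d} → bound f ≤ d →
  eval f x ≡ sumMap (term f x) (exponents m d)
eval≡sumMap f x b≤d = sym (sumMap-exponents (term f x)
  (λ e b<e → trans (cong (ℚ._* fromℕ (monomial e x)) (vanishes f e b<e))
                   (ℚ.*-zeroˡ (fromℕ (monomial e x))))
  (≤⇒≤′ b≤d))

eval-cong : ∀ {m} (f g : Polynomial m) x y → (∀ e → term f x e ≡ term g y e) → eval f x ≡ eval g y
eval-cong {m} f g x y eq = begin
  eval f x                          ≡⟨ eval≡sumMap f x (m≤m⊔n (bound f) (bound g)) ⟩
  sumMap (term f x) (exponents m d) ≡⟨ sumMap-cong eq (exponents m d) ⟩
  sumMap (term g y) (exponents m d) ≡⟨ eval≡sumMap g y (m≤n⊔m (bound f) (bound g)) ⟨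
  eval g y                          ∎
  where
  open ≡-Reasoning
  d = bound f ℕ.⊔ bound g

^-distribʳ-* : ∀ a b n → (a * b) ^ n ≡ a ^ n * b ^ n
^-distribʳ-* a b zero = refl
^-distribʳ-* a b (suc n) =
  trans (cong (a * b *_) (^-distribʳ-* a b n)) ([m*n]*[o*p]≡[m*o]*[n*p] a b _ _)

monomial-scale : ∀ {m} k (e : Exponent m) x →
  monomial e (Vec.map (k *_) x) ≡ k ^ ∣ e ∣ * monomial e x
monomial-scale k [] [] = refl
monomial-scale k (n ∷ e) (a ∷ x) = begin
  (k * a) ^ n * monomial e (Vec.map (k *_) x)
    ≡⟨ cong₂ _*_ (^-distribʳ-* k a n) (monomial-scale k e x) ⟩
  k ^ n * a ^ n * (k ^ ∣ e ∣ * monomial e x)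
    ≡⟨ [m*n]*[o*p]≡[m*o]*[n*p] (k ^ n) _ _ _ ⟩
  k ^ n * k ^ ∣ e ∣ * (a ^ n * monomial e x)
    ≡⟨ cong (_* (a ^ n * monomial e x)) (^-distribˡ-+-* k n ∣ e ∣) ⟨
  k ^ (n + ∣ e ∣) * (a ^ n * monomial e x)
    ∎
  where open ≡-Reasoning

∣e∣≡0⇒e≡0 : ∀ {m} (e : Exponent m) → ∣ e ∣ ≡ 0 → e ≡ Vec.replicate m 0
∣e∣≡0⇒e≡0 [] _ = refl
∣e∣≡0⇒e≡0 (zero ∷ e) eq = cong (0 ∷_) (∣e∣≡0⇒e≡0 e eq)

module _ {m} (f g : Polynomial m) (α : ℚ)
  (g≡αf : ∀ e → coeff g e ≡ (α ℚ^.^ ∣ e ∣) ℚ.* coeff f e) where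

  eval-scale : NoOppositeSigns f g → ∀ x →
    eval g (Vec.map (↧ₙ α *_) x) ≡ eval f (Vec.map (ℤ.∣ ↥ α ∣ *_) x)
  eval-scale ns x = eval-cong g f (Vec.map (↧ₙ α *_) x) (Vec.map (ℤ.∣ ↥ α ∣ *_) x) term≡
    where
    term≡ : ∀ e → term g (Vec.map (↧ₙ α *_) x) e ≡ term f (Vec.map (ℤ.∣ ↥ α ∣ *_) x) e
    term≡ e = begin
      coeff g e ℚ.* fromℕ (monomial e (Vec.map (q *_) x))
        ≡⟨ cong₂ (λ c n → c ℚ.* fromℕ n) coeff≡ (monomial-scale q e x) ⟩
      (s ℚ.* a) ℚ.* fromℕ (q ^ ∣ e ∣ * M)
        ≡⟨ cong ((s ℚ.* a) ℚ.*_) (fromℕ-* (q ^ ∣ e ∣) M) ⟩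
      (s ℚ.* a) ℚ.* (fromℕ (q ^ ∣ e ∣) ℚ.* fromℕ M)
        ≡⟨ interchange s a (fromℕ (q ^ ∣ e ∣)) (fromℕ M) ⟩
      (s ℚ.* fromℕ (q ^ ∣ e ∣)) ℚ.* (a ℚ.* fromℕ M)
        ≡⟨ cong (ℚ._* (a ℚ.* fromℕ M)) (∣p∣^n*↧p^n α ∣ e ∣) ⟩
      fromℕ (p ^ ∣ e ∣) ℚ.* (a ℚ.* fromℕ M)
        ≡⟨ x∙yz≈y∙xz (fromℕ (p ^ ∣ e ∣)) a (fromℕ M) ⟩
      a ℚ.* (fromℕ (p ^ ∣ e ∣) ℚ.* fromℕ M)
        ≡⟨ cong (a ℚ.*_) (fromℕ-* (p ^ ∣ e ∣) M) ⟨
      a ℚ.* fromℕ (p ^ ∣ e ∣ * M)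
        ≡⟨ cong (λ n → a ℚ.* fromℕ n) (monomial-scale p e x) ⟨
      a ℚ.* fromℕ (monomial e (Vec.map (p *_) x))
        ∎
      where
      open ≡-Reasoning
      p = ℤ.∣ ↥ α ∣
      q = ↧ₙ α
      a = coeff f e
      s = ℚ.∣ α ∣ ℚ^.^ ∣ e ∣
      M = monomial e x

      coeff≡ : coeff g e ≡ s ℚ.* a
      coeff≡ = begin
        coeff g e
          ≡⟨ g≡αf e ⟩
        (α ℚ^.^ ∣ e ∣) ℚ.* a
          ≡⟨ 0≤a*sa⇒sa≡∣s∣a (α ℚ^.^ ∣ e ∣) a
               (subst (λ b → 0ℚ ℚ.≤ a ℚ.* b) (g≡αf e) (ns e)) ⟩
        ℚ.∣ α ℚ^.^ ∣ e ∣ ∣ ℚ.* a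
          ≡⟨ cong (ℚ._* a) (∣p^n∣ α ∣ e ∣) ⟩
        s ℚ.* a
          ∎

  -- With `α = 0` only the constant coefficient of `g` could survive, and it equals that of `f`,
  -- which is 0. Then `g` would vanish at `(1, …, 1)`, against positivity.
  0<∣↥α∣ : NoConstantTerm f → MapsPositivesToPositives g → 0 < ℤ.∣ ↥ α ∣
  0<∣↥α∣ nc g>0 = n≢0⇒n>0 λ ∣↥α∣≡0 →
    let α≡0 = ℚ.↥p≡0⇒p≡0 α (ℤ.∣i∣≡0⇒i≡0 ∣↥α∣≡0)
        k , k>0 , eq = g>0 x (positive m)
    in <⇒≢ k>0 (sym (fromℕ-injective (trans (sym eq)
         (sumMap-0 (λ e → term≡0 e (coeff≡0 α≡0 e)) (exponents m (bound g))))))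
    where
    x = Vec.replicate m 1

    term≡0 : ∀ e → coeff g e ≡ 0ℚ → term g x e ≡ 0ℚ
    term≡0 e c≡0 = trans (cong (ℚ._* fromℕ (monomial e x)) c≡0) (ℚ.*-zeroˡ (fromℕ (monomial e x)))

    positive : ∀ n → VecAll.All (0 <_) (Vec.replicate n 1)
    positive zero = []
    positive (suc n) = s≤s z≤n ∷ positive n

    coeff≡0 : α ≡ 0ℚ → ∀ e → coeff g e ≡ 0ℚ
    coeff≡0 refl e rewrite g≡αf e with ∣ e ∣ in eq
    ... | zero rewrite ∣e∣≡0⇒e≡0 e eq | nc = refl
    ... | suc n = trans (cong (ℚ._* coeff f e) (ℚ.*-zeroˡ (0ℚ ℚ^.^ n))) (ℚ.*-zeroˡ (coeff f e))

-- Sums over increasing blocks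

Seq : Set
Seq = ℕ → ℕ

-- BlockSums z (a₁ ∷ … ∷ aₘ): each aᵢ is the sum of z over βᵢ for some nonempty
-- finite β₁ < … < βₘ.
data BlockSums (z : Seq) : ∀ {m} → Vec ℕ m → Set where
  []   : BlockSums z []
  skip : ∀ {m} {as : Vec ℕ m} → BlockSums (z ∘ suc) as → BlockSums z as
  new  : ∀ {m} {as : Vec ℕ m} → BlockSums (z ∘ suc) as → BlockSums z (z 0 ∷ as)
  add  : ∀ {m a} {as : Vec ℕ m} →
         BlockSums (z ∘ suc) (a ∷ as) → BlockSums z (z 0 + a ∷ as)

-- Where the first block would close, the `new` for its last term becomes an `add`, which runs on
-- into the second block.
merge : ∀ {z m a b} {as : Vec ℕ m} → BlockSums z (a ∷ b ∷ as) → BlockSums z (a + b ∷ as)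
merge (skip p) = skip (merge p)
merge (new p) = add p
merge {z} {b = b} {as} (add {a = a} p) =
  subst (λ c → BlockSums z (c ∷ as)) (sym (+-assoc (z 0) a b)) (add (merge p))

dropHead : ∀ {z m a} {as : Vec ℕ m} → BlockSums z (a ∷ as) → BlockSums z as
dropHead (skip p) = skip (dropHead p)
dropHead (new p) = skip p
dropHead (add p) = skip (dropHead p)

takeHead : ∀ {z m a} {as : Vec ℕ m} → BlockSums z (a ∷ as) → BlockSums z (a ∷ [])
takeHead (skip p) = skip (takeHead p)
takeHead (new p) = new []
takeHead (add p) = add (takeHead p)

infix 4 _⊑_ _⟨_⟩⟶_

-- Refinement is inclusion of block sums, so that no bookkeeping of the blocks
-- themselves is needed.
_⊑_ : Seq → Seq → Set
y ⊑ z = ∀ {m} {as : Vec ℕ m} → BlockSums y as → BlockSums z as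

record _⟨_⟩⟶_ (z : Seq) (a : ℕ) (y : Seq) : Set where
  constructor step
  field
    prepend : ∀ {m} {as : Vec ℕ m} → BlockSums y as → BlockSums z (a ∷ as)

open _⟨_⟩⟶_

⟶⇒⊑ : ∀ {z a y} → z ⟨ a ⟩⟶ y → y ⊑ z
⟶⇒⊑ s = dropHead ∘ prepend s

⟶-⊑ : ∀ {x y z a} → z ⟨ a ⟩⟶ y → x ⊑ y → z ⟨ a ⟩⟶ x
⟶-⊑ s x⊑y = step (prepend s ∘ x⊑y)

⊑-⟶ : ∀ {x y z a} → y ⊑ z → y ⟨ a ⟩⟶ x → z ⟨ a ⟩⟶ x
⊑-⟶ y⊑z s = step (y⊑z ∘ prepend s)

⟶-merge : ∀ {x y z a b} → z ⟨ a ⟩⟶ y → y ⟨ b ⟩⟶ x → z ⟨ a + b ⟩⟶ x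
⟶-merge s t = step (merge ∘ prepend s ∘ prepend t)

-- The witness is the tail of `z` after the last term of the block with sum `a`.
split : ∀ {z a m} {as : Vec ℕ m} → BlockSums z (a ∷ as) → ∃ λ y → z ⟨ a ⟩⟶ y
split (skip p) with split p
... | y , s = y , step (skip ∘ prepend s)
split {z} (new p) = z ∘ suc , step new
split (add p) with split p
... | y , s = y , step (add ∘ prepend s)

-- The limit step of the infinite constructions below: successive choices form a single refinement.
fusion : (w : ℕ → Seq) (e : Seq) → (∀ n → w n ⟨ e n ⟩⟶ w (suc n)) → e ⊑ w 0
fusion w e s [] = []
fusion w e s (skip p) = ⟶⇒⊑ (s 0) (fusion (w ∘ suc) (e ∘ suc) (s ∘ suc) p)
fusion w e s (new p) = prepend (s 0) (fusion (w ∘ suc) (e ∘ suc) (s ∘ suc) p)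
fusion w e s (add p) = merge (prepend (s 0) (fusion (w ∘ suc) (e ∘ suc) (s ∘ suc) p))

⊑-positive : ∀ {y z} → y ⊑ z → (∀ n → 0 < z n) → ∀ n → 0 < y n
⊑-positive {y} {z} y⊑z z>0 n = positive z>0 (y⊑z (element y n))
  where
  element : ∀ x n → BlockSums x (x n ∷ [])
  element x zero = new []
  element x (suc n) = skip (element (x ∘ suc) n)

  positive : ∀ {x a} → (∀ n → 0 < x n) → BlockSums x (a ∷ []) → 0 < a
  positive x>0 (skip p) = positive (x>0 ∘ suc) p
  positive x>0 (new p) = x>0 0
  positive x>0 (add p) = ≤-trans (x>0 0) (m≤m+n _ _)

-- Hindman's theorem

Meets : Pred ℕ 0ℓ → Seq → Set
Meets X z = ∃ λ a → BlockSums z (a ∷ []) × X a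

Large : Pred ℕ 0ℓ → Seq → Set
Large X z = ∀ y → y ⊑ z → Meets X y

infixl 7 _∩_-_

_∩_-_ : Pred ℕ 0ℓ → Pred ℕ 0ℓ → ℕ → Pred ℕ 0ℓ
(X ∩ Y - e) x = X x × Y (e + x)

orbit : ∀ {ℓ} {S : Set ℓ} → (S → S) → S → ℕ → S
orbit next s zero = s
orbit next s (suc n) = next (orbit next s n)

module Classical (em : ExcludedMiddle 0ℓ) where

  -- Either the first set is large for `z`, or some refinement `y` avoids it; in the latter case the
  -- remaining sets together are large for `y`, and induction applies.
  large-Any : ∀ {I : Set} (P : I → Pred ℕ 0ℓ) is {z} →
    Large (λ a → Any (λ i → P i a) is) z →
    ∃ λ i → i ∈ is × ∃ λ y → y ⊑ z × Large (P i) y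
  large-Any P [] {z} l with l z id
  ... | _ , _ , ()
  large-Any P (i ∷ is) {z} l with em {P = ∃ λ y → y ⊑ z × ¬ Meets (P i) y}
  ... | no ¬avoid = i , here refl , z , id , meets
    where
    meets : Large (P i) z
    meets y y⊑z with em {P = Meets (P i) y}
    ... | yes mt = mt
    ... | no ¬mt = ⊥-elim (¬avoid (y , y⊑z , ¬mt))
  ... | yes (y , y⊑z , ¬mt) with large-Any P is rest
    where
    rest : Large (λ a → Any (λ i → P i a) is) y
    rest x x⊑y with l x (y⊑z ∘ x⊑y)
    ... | a , a∈x , here Pia = ⊥-elim (¬mt (a , x⊑y a∈x , Pia))
    ... | a , a∈x , there Pa = a , a∈x , Pa
  ... | j , j∈is , x , x⊑y , lx = j , there j∈is , x , y⊑z ∘ x⊑y , lx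

  module _ {X : Pred ℕ 0ℓ} {z : Seq} where

    -- A finite stage of the construction: `sums` lists sums of elements chosen so far, and `rest`
    -- is what remains beyond their blocks.
    record Prefix : Set where
      constructor prefix
      field
        sums  : List ℕ
        rest  : Seq
        below : rest ⊑ z
        steps : All (λ e → z ⟨ e ⟩⟶ rest) sums

    open Prefix

    Covers : Prefix → Set
    Covers E = ∀ d → BlockSums (rest E) (d ∷ []) → Any (λ e → X (e + d)) (sums E)

    -- If `sums` consists of all finite sums of the elements chosen so far, adding `d` and every
    -- `e + d` keeps it so.
    extend : (E : Prefix) → ∀ {d} → BlockSums (rest E) (d ∷ []) →
      ∃ λ F → d ∈ sums F × (∀ {e} → e ∈ sums E → e ∈ sums F × e + d ∈ sums F)
            × rest E ⟨ d ⟩⟶ rest F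
    extend (prefix L y y⊑z ss) {d} d∈y with split d∈y
    ... | x , s =
      prefix (d ∷ L ++ List.map (_+ d) L) x (y⊑z ∘ ⟶⇒⊑ s)
        (⊑-⟶ y⊑z s ∷ All.++⁺ (All.map (λ t → ⟶-⊑ t (⟶⇒⊑ s)) ss)
                              (All.map⁺ (All.map (λ t → ⟶-merge t s) ss))) ,
      here refl ,
      (λ e∈L → there (∈-++⁺ˡ e∈L) , there (∈-++⁺ʳ L (∈-map⁺ (_+ d) e∈L))) ,
      s

    Avoids : Prefix → ℕ → Set
    Avoids E x = ¬ X x × (∀ {e} → e ∈ sums E → ¬ X (e + x))

    record _▷_ (E : Prefix) (x : ℕ) : Set where
      field
        avoids  : Avoids E x
        next    : Prefix
        steps   : rest E ⟨ x ⟩⟶ rest next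
        new∈    : x ∈ sums next
        old∈    : ∀ {e} → e ∈ sums E → e ∈ sums next
        sum∈    : ∀ {e} → e ∈ sums E → e + x ∈ sums next

    open _▷_

    -- If no prefix covers, then choosing uncovered elements one after the other
    -- yields a refinement none of whose sums lies in X.  A single uncovered choice
    -- may itself lie in X, hence two consecutive choices are added.
    avoid : (∀ E → ¬ Covers E) → ∀ E → ∃ (E ▷_)
    avoid ¬covers E
      with F , d∈F , old , s ← extend E {rest E 0} (new [])
      with em {P = ∃ λ d → BlockSums (rest F) (d ∷ []) × ¬ Any (λ e → X (e + d)) (sums F)}
    ... | no ¬uncovered = ⊥-elim (¬covers F covers)
      where
      covers : Covers F
      covers d d∈F with em {P = Any (λ e → X (e + d)) (sums F)}
      ... | yes c = c
      ... | no ¬c = ⊥-elim (¬uncovered (d , d∈F , ¬c))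
    ... | yes (d , d∈rest , ¬c) with G , _ , old′ , t ← extend F d∈rest = rest E 0 + d , record
      { avoids = ¬c ∘ lose d∈F , λ {e} e∈E Xe →
          ¬c (lose (proj₂ (old e∈E)) (subst X (sym (+-assoc e _ d)) Xe))
      ; next = G
      ; steps = ⟶-merge s t
      ; new∈ = proj₂ (old′ d∈F)
      ; old∈ = λ e∈E → proj₁ (old′ (proj₁ (old e∈E)))
      ; sum∈ = λ {e} e∈E →
          subst (_∈ sums G) (+-assoc e _ d) (proj₂ (old′ (proj₂ (old e∈E))))
      }

    -- Avoidance must include the translates by `sums (E 0)` for the induction to work: `x 0`
    -- belongs to `sums (E 1)`, so the claim for `a` one stage later already excludes `x 0 + a` from
    -- `X`.
    blockSums-avoid : (E : ℕ → Prefix) (x : Seq) (ch : ∀ n → E n ▷ x n) →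
      (∀ n → E (suc n) ≡ next (ch n)) →
      ∀ {a} → BlockSums x (a ∷ []) → Avoids (E 0) a
    blockSums-avoid E x ch eq (new _) = avoids (ch 0)
    blockSums-avoid E x ch eq (skip p)
      with blockSums-avoid (E ∘ suc) (x ∘ suc) (ch ∘ suc) (eq ∘ suc) p
    ... | ¬Xa , ¬Xea rewrite eq 0 = ¬Xa , ¬Xea ∘ old∈ (ch 0)
    blockSums-avoid E x ch eq (add {a = a} p)
      with blockSums-avoid (E ∘ suc) (x ∘ suc) (ch ∘ suc) (eq ∘ suc) p
    ... | ¬Xa , ¬Xea rewrite eq 0 =
      ¬Xea (new∈ (ch 0)) ,
      λ {e} e∈E Xe → ¬Xea (sum∈ (ch 0) e∈E) (subst X (sym (+-assoc e (x 0) a)) Xe)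

    large⇒covered : Large X z → ∃ Covers
    large⇒covered l with em {P = ∃ Covers}
    ... | yes c = c
    ... | no ¬c = ⊥-elim contra
      where
      choose : ∀ E → ∃ (E ▷_)
      choose = avoid (λ E c → ¬c (E , c))

      E : ℕ → Prefix
      E = orbit (λ E → next (proj₂ (choose E))) (prefix [] z id [])

      x : Seq
      x n = proj₁ (choose (E n))

      contra : _
      contra with l x (fusion (rest ∘ E) x (λ n → steps (proj₂ (choose (E n)))))
      ... | a , a∈x , Xa =
        proj₁ (blockSums-avoid E x (λ n → proj₂ (choose (E n))) (λ n → refl) a∈x) Xa

  abstract
    -- Beyond a covering prefix, each block sum in `X` also lies in `X - e` for one of finitely many
    -- `e`. So the sets `X ∩ X - e` are jointly large, and `large-Any` singles out one of them.
    large-step : ∀ {X z} → Large X z →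
      ∃₂ λ e y → z ⟨ e ⟩⟶ y × Large (X ∩ X - e) y
    large-step {X} {z} l
      with prefix L y y⊑z ss , covers ← large⇒covered l
      with e , e∈L , x , x⊑y , lx ← large-Any (λ e → X ∩ X - e) L {y} (λ w w⊑y →
        let a , a∈w , Xa = l w (y⊑z ∘ w⊑y)
        in a , a∈w , Any.map (Xa ,_) (covers a (w⊑y a∈w)))
      = e , x , ⟶-⊑ (All.lookup ss e∈L) x⊑y , lx

  record Stage : Set₁ where
    constructor stage
    field
      {set} : Pred ℕ 0ℓ
      {seq} : Seq
      large : Large set seq

  open Stage

  -- Run twice: with `large-step`, whose chosen numbers need not lie in the set, and then with the
  -- sharper `large-step∈`.
  module Iterate
    (next : ∀ {X z} → Large X z → ∃₂ λ e y → z ⟨ e ⟩⟶ y × Large (X ∩ X - e) y)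
    {X z} (l : Large X z) where

    stages : ℕ → Stage
    stages = orbit (λ s → stage (proj₂ (proj₂ (proj₂ (next (large s)))))) (stage l)

    chosen : Seq
    chosen n = proj₁ (next (large (stages n)))

    chosen-step : ∀ n → seq (stages n) ⟨ chosen n ⟩⟶ seq (stages (suc n))
    chosen-step n = proj₁ (proj₂ (proj₂ (next (large (stages n)))))

    chosen-⊑ : chosen ⊑ z
    chosen-⊑ = fusion (seq ∘ stages) chosen chosen-step

  large-mono : ∀ {X Y z} → X ⊆ Y → Large X z → Large Y z
  large-mono X⊆Y l y y⊑z with l y y⊑z
  ... | a , a∈y , Xa = a , a∈y , X⊆Y Xa

  -- Single steps compose to one step by their sum: `X k ⊆ X 1 - a` and `X 1 ⊆ X 0 - e 0` give
  -- `X k ⊆ X 0 - (e 0 + a)`.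
  set-fusion : (w : ℕ → Seq) (X : ℕ → Pred ℕ 0ℓ) (e : Seq) →
    (∀ n → w n ⟨ e n ⟩⟶ w (suc n)) → (∀ n → X (suc n) ⊆ X n ∩ X n - e n) →
    ∀ {a} → BlockSums e (a ∷ []) →
    ∃ λ k → w 0 ⟨ a ⟩⟶ w k × X k ⊆ X 0 ∩ X 0 - a
  set-fusion w X e s X⊆ (new _) = 1 , s 0 , X⊆ 0
  set-fusion w X e s X⊆ (skip p)
    with k , t , Xk ← set-fusion (w ∘ suc) (X ∘ suc) (e ∘ suc) (s ∘ suc) (X⊆ ∘ suc) p =
    suc k , ⊑-⟶ (⟶⇒⊑ (s 0)) t ,
    λ x → proj₁ (X⊆ 0 (proj₁ (Xk x))) , proj₁ (X⊆ 0 (proj₂ (Xk x)))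
  set-fusion w X e s X⊆ (add {a = a} p)
    with k , t , Xk ← set-fusion (w ∘ suc) (X ∘ suc) (e ∘ suc) (s ∘ suc) (X⊆ ∘ suc) p =
    suc k , ⟶-merge (s 0) t ,
    λ {x} q → proj₁ (X⊆ 0 (proj₁ (Xk q))) ,
      subst (X 0) (sym (+-assoc (e 0) a x)) (proj₂ (X⊆ 0 (proj₂ (Xk q))))

  abstract
    -- The numbers chosen by iterating `large-step` form a refinement of `z`, so by largeness some
    -- finite sum of them lies in `X`; `set-fusion` turns this sum into a single step.
    large-step∈ : ∀ {X z} → Large X z →
      ∃ λ e → X e × ∃ λ y → z ⟨ e ⟩⟶ y × Large (X ∩ X - e) y
    large-step∈ l =
      let a , a∈ , Xa = l _ chosen-⊑
          k , t , X⊆ =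
            set-fusion (seq ∘ stages) (set ∘ stages) chosen chosen-step (λ _ x → x) a∈
      in a , Xa , _ , t , large-mono X⊆ (large (stages k))
      where open Iterate large-step l

    -- Iterating `large-step∈` puts each chosen `e n` into the current set `X n`. Summing from the
    -- last term backwards, `a` in `X (suc n)` gives `e n + a` in `X n`, so every finite sum reaches
    -- `X 0`.
    large⇒homogeneous : ∀ {X z} → Large X z →
      ∃ λ y → y ⊑ z × ∀ {a} → BlockSums y (a ∷ []) → X a
    large⇒homogeneous l = chosen , chosen-⊑ , blockSums-∈ (set ∘ stages) chosen
      (λ n → proj₁ (proj₂ (large-step∈ (large (stages n))))) (λ _ x → x)
      where
      next : ∀ {X z} → Large X z → ∃₂ λ e y → z ⟨ e ⟩⟶ y × Large (X ∩ X - e) y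
      next l = let e , _ , y , s , l′ = large-step∈ l in e , y , s , l′

      open Iterate next l

      blockSums-∈ : (X : ℕ → Pred ℕ 0ℓ) (e : Seq) → (∀ n → X n (e n)) →
        (∀ n → X (suc n) ⊆ X n ∩ X n - e n) → ∀ {a} → BlockSums e (a ∷ []) → X 0 a
      blockSums-∈ X e e∈ X⊆ (new _) = e∈ 0
      blockSums-∈ X e e∈ X⊆ (skip p) =
        proj₁ (X⊆ 0 (blockSums-∈ (X ∘ suc) (e ∘ suc) (e∈ ∘ suc) (X⊆ ∘ suc) p))
      blockSums-∈ X e e∈ X⊆ (add p) =
        proj₂ (X⊆ 0 (blockSums-∈ (X ∘ suc) (e ∘ suc) (e∈ ∘ suc) (X⊆ ∘ suc) p))

    hindman : ∀ {r} (c : ℕ → Fin r) z →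
      ∃₂ λ y i → y ⊑ z × ∀ {a} → BlockSums y (a ∷ []) → c a ≡ i
    hindman c z =
      let i , _ , y , y⊑z , l = large-Any (λ i a → c a ≡ i) (List.allFin _) {z}
            -- The colour classes together contain every number, so any term, here `y 0`, shows
            -- their union to be large.
            (λ y _ → y 0 , new [] , lose (∈-allFin (c (y 0))) refl)
          x , x⊑y , eq = large⇒homogeneous l
      in x , i , y⊑z ∘ x⊑y , eq

  -- The Milliken–Taylor theorem

  module _ {r m} (c : Vec ℕ (suc m) → Fin r)
    (ih : ∀ (c : Vec ℕ m → Fin r) z → ∃₂ λ y i → y ⊑ z × ∀ {as} → BlockSums y as → c as ≡ i)
    (z : Seq) where

    -- Stage `n` treats the number `n` itself as a possible first entry, whether or not it is a
    -- block sum. Passing to the tail keeps the leading term of `decided n` free for the diagonal.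
    decided : ℕ → Seq
    decided zero = z
    decided (suc n) = proj₁ (ih (c ∘ (n ∷_)) (decided n ∘ suc))

    color : ℕ → Fin r
    color n = proj₁ (proj₂ (ih (c ∘ (n ∷_)) (decided n ∘ suc)))

    color-decided : ∀ n {as} → BlockSums (decided (suc n)) as → c (n ∷ as) ≡ color n
    color-decided n = proj₂ (proj₂ (proj₂ (ih (c ∘ (n ∷_)) (decided n ∘ suc))))

    decided-⊑-tail : ∀ n → decided (suc n) ⊑ decided n ∘ suc
    decided-⊑-tail n = proj₁ (proj₂ (proj₂ (ih (c ∘ (n ∷_)) (decided n ∘ suc))))

    decided-antitone : ∀ {i j} → i ≤ j → decided j ⊑ decided i
    decided-antitone i≤j = go (≤⇒≤′ i≤j)
      where
      go : ∀ {i j} → i ≤′ j → decided j ⊑ decided i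
      go ≤′-refl p = p
      go (≤′-step q) p = go q (skip (decided-⊑-tail _ p))

    -- The next index exceeds every sum of the terms chosen so far, so that the
    -- tuples chosen later are decided for each of these sums.
    index : ℕ → ℕ → ℕ
    index k zero = k
    index k (suc n) = index (suc (k + decided k 0)) n

    diagonal : ℕ → Seq
    diagonal k n = decided (index k n) 0

    index-suc : ∀ k n → index k (suc n) ≡ suc (index k n + diagonal k n)
    index-suc k zero = refl
    index-suc k (suc n) = index-suc _ n

    diagonal-⊑ : ∀ k → diagonal k ⊑ decided k
    diagonal-⊑ k = fusion (decided ∘ index k) (diagonal k) steps
      where
      steps : ∀ n → decided (index k n) ⟨ diagonal k n ⟩⟶ decided (index k (suc n))
      steps n rewrite index-suc k n =
        step (λ p → new (decided-⊑-tail (index k n)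
          (decided-antitone (s≤s (m≤m+n (index k n) (diagonal k n))) p)))

    -- An arbitrary start `k` lets the induction pass to tails, since the tail of a diagonal is the
    -- diagonal from the next index. For `k = 0`, what follows a block of sum `a` lies in
    -- `decided (suc a)`, where the colour of `a ∷ as` is settled.
    diagonal-rest : ∀ k {a l} {as : Vec ℕ l} →
      BlockSums (diagonal k) (a ∷ as) → BlockSums (decided (suc (k + a))) as
    diagonal-rest k (new p) = diagonal-⊑ _ p
    diagonal-rest k {a} (skip p) =
      decided-antitone (s≤s (≤-trans (+-monoˡ-≤ a (m≤m+n k _)) (n≤1+n _))) (diagonal-rest _ p)
    diagonal-rest k (add {a = a} p) =
      decided-antitone (s≤s (≤-trans (≤-reflexive (sym (+-assoc k _ a))) (n≤1+n _)))
        (diagonal-rest _ p)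

  milliken-taylor : ∀ {r m} (c : Vec ℕ m → Fin r) z →
    ∃₂ λ y i → y ⊑ z × ∀ {as} → BlockSums y as → c as ≡ i
  milliken-taylor {m = zero} c z = z , c [] , id , λ { {[]} _ → refl }
  milliken-taylor {m = suc m} c z =
    -- On the diagonal the colour of `a ∷ as` is a function of `a` alone, and Hindman's theorem
    -- makes this function constant.
    let x , i , x⊑ , eq = hindman (color c milliken-taylor z) (diagonal c milliken-taylor z 0)
    in x , i , diagonal-⊑ c milliken-taylor z 0 ∘ x⊑ , λ { {a ∷ as} p →
        trans (color-decided c milliken-taylor z a (diagonal-rest c milliken-taylor z 0 (x⊑ p)))
              (eq (takeHead p)) }

-- From finite index sets to block sums

shift : ℕ → Seq → Seq
-- In this order `shift k z 0` computes to `z k`, the term that `new` and `add` consume.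
shift k z n = z (n + k)

⊑-cong : ∀ {y z} → (∀ n → y n ≡ z n) → y ⊑ z
⊑-cong eq [] = []
⊑-cong eq (skip p) = skip (⊑-cong (eq ∘ suc) p)
⊑-cong eq (new p) rewrite eq 0 = new (⊑-cong (eq ∘ suc) p)
⊑-cong eq (add p) rewrite eq 0 = add (⊑-cong (eq ∘ suc) p)

shift-suc : ∀ z k → shift (suc k) z ⊑ shift k z ∘ suc
shift-suc z k = ⊑-cong λ n → cong z (+-suc n k)

shift-antitone : ∀ z {k l} → k ≤ l → shift l z ⊑ shift k z
shift-antitone z k≤l = go (≤⇒≤′ k≤l)
  where
  go : ∀ {k l} → k ≤′ l → shift l z ⊑ shift k z
  go ≤′-refl p = p
  go (≤′-step {l} q) p = go q (skip (shift-suc z l p))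

-- `k` is the position reached so far and `n` a position beyond the block. Gaps between elements are
-- skipped by `shift-antitone`; each element is taken by `add`, the last one by `new`.
blockSums-block : ∀ z {k n m i is} {as : Vec ℕ m} →
  k ≤ i → Linked _<_ (i ∷ is) → All (_< n) (i ∷ is) →
  BlockSums (shift n z) as → BlockSums (shift k z) (sum (List.map z (i ∷ is)) ∷ as)
blockSums-block z {i = i} {as = as} k≤i [-] (i<n ∷ []) p =
  shift-antitone z k≤i (subst (λ a → BlockSums (shift i z) (a ∷ as)) (sym (+-identityʳ (z i)))
    (new (shift-suc z i (shift-antitone z i<n p))))
blockSums-block z {i = i} k≤i (i<j ∷ inc) (_ ∷ is<n) p =
  shift-antitone z k≤i (add (shift-suc z i (blockSums-block z i<j inc is<n p)))

max-upper : ∀ x xs → All (_≤ List⁺.foldr₁ _⊔_ (x ∷ xs)) (x ∷ xs)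
max-upper x [] = ≤-refl ∷ []
max-upper x (y ∷ xs) =
  m≤m⊔n x _ ∷ All.map (λ q → ≤-trans q (m≤n⊔m x _)) (max-upper y xs)

min-≤-head : ∀ x xs → List⁺.foldr₁ ℕ._⊓_ (x ∷ xs) ≤ x
min-≤-head x [] = ≤-refl
min-≤-head x (y ∷ xs) = m⊓n≤m x _

blockSums-MT : ∀ z {m} (β : Vec FiniteSubset⁺ m) → VecLinked.Linked _≺_ β →
  BlockSums z (Vec.map (sumOver z) β)
blockSums-MT z [] [] = []
blockSums-MT z (b ∷ β) linked = ⊑-cong (λ n → cong z (+-identityʳ n)) (go 0 b β z≤n linked)
  where
  go : ∀ k {m} b (β : Vec FiniteSubset⁺ m) → k ≤ min b → VecLinked.Linked _≺_ (b ∷ β) →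
    BlockSums (shift k z) (Vec.map (sumOver z) (b ∷ β))
  go k record { elements = i ∷ is ; increasing = inc } [] k≤b [-] =
    blockSums-block z (≤-trans k≤b (min-≤-head i is)) inc (All.map s≤s (max-upper i is)) []
  go k record { elements = i ∷ is ; increasing = inc } (c ∷ β) k≤b (b≺c ∷ linked) =
    blockSums-block z (≤-trans k≤b (min-≤-head i is)) inc (All.map s≤s (max-upper i is))
      -- `b≺c` unfolds to `suc (max b) ≤ min c`, so the next block starts from position
      -- `suc (max b)`.
      (go _ c β b≺c linked)

sumOver-scale : ∀ k z β → sumOver (λ n → k * z n) β ≡ k * sumOver z β
sumOver-scale k z β = go (List⁺.toList (elements β))
  where
  go : ∀ is → sum (List.map (λ n → k * z n) is) ≡ k * sum (List.map z is)
  go [] = sym (*-zeroʳ k)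
  go (i ∷ is) = trans (cong (k * z i +_) (go is)) (sym (*-distribˡ-+ k (z i) _))

sumOver-positive : ∀ {z} → (∀ n → 0 < z n) → ∀ β → 0 < sumOver z β
sumOver-positive z>0 record { elements = i ∷ is } = ≤-trans (z>0 i) (m≤m+n _ _)

theorem3p5 : ExcludedMiddle 0ℓ →
    ∀ (r m : ℕ) .{{_ : NonZero r}} .{{_ : NonZero m}}
    (f g : Polynomial m) →
    MapsPositivesToPositives f → MapsPositivesToPositives g →
    NoConstantTerm f → NoConstantTerm g →
    f ≈ g →
    NoOppositeSigns f g →
    (A : Fin r → Pred ℕ 0ℓ) → IsColoring A →
    ∃₂ λ (x y : ℕ → ℕ) →
    (∀ n → 0 < x n) × (∀ n → 0 < y n) ×
    ∃ λ (i : Fin r) → MT f x ∪ MT g y ⊆ A i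
theorem3p5 em r m f g f>0 g>0 ncf _ (_ , α , g≡αf) ns A col =
  (λ n → p * z n) , (λ n → q * z n) ,
  (λ n → *-mono-≤ p>0 (z>0 n)) , (λ n → *-mono-≤ {1} {q} (s≤s z≤n) (z>0 n)) ,
  i , λ { (inj₁ k∈) → MT-f k∈ ; (inj₂ k∈) → MT-g k∈ }
  where
  p = ℤ.∣ ↥ α ∣
  q = ↧ₙ α

  p>0 : 0 < p
  p>0 = 0<∣↥α∣ f g α g≡αf ncf g>0

  -- suc (pred a) is a on the positive arguments and makes the colour below
  -- defined on all of them.
  argument : ∀ {n} → Vec ℕ n → Vec ℕ n
  argument = Vec.map (λ a → p * suc (pred a))

  argument>0 : ∀ {n} (as : Vec ℕ n) → VecAll.All (0 <_) (argument as)
  argument>0 [] = []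
  argument>0 (a ∷ as) = *-mono-≤ p>0 (s≤s z≤n) ∷ argument>0 as

  value : ∀ as → ∃ λ k → 0 < k × eval f (argument as) ≡ fromℕ k
  value as = f>0 (argument as) (argument>0 as)

  color : ∀ as → ∃ λ i → A i (proj₁ (value as))
  color as = let _ , k>0 , _ = value as
                 i , k∈Ai , _ = col _ k>0
             in i , k∈Ai

  homogeneous : ∃₂ λ z i → z ⊑ (λ _ → 1) × ∀ {as} → BlockSums z as → proj₁ (color as) ≡ i
  -- Starting from positive terms, here all 1, makes `z` positive by `⊑-positive`.
  homogeneous = Classical.milliken-taylor em (proj₁ ∘ color) (λ _ → 1)

  z : Seq
  z = proj₁ homogeneous

  i : Fin r
  i = proj₁ (proj₂ homogeneous)

  z>0 : ∀ n → 0 < z n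
  z>0 = ⊑-positive (proj₁ (proj₂ (proj₂ homogeneous))) (λ _ → s≤s z≤n)

  map-sumOver-scale : ∀ {n} k (β : Vec FiniteSubset⁺ n) →
    Vec.map (sumOver (λ n → k * z n)) β ≡ Vec.map (k *_) (Vec.map (sumOver z) β)
  map-sumOver-scale k β =
    trans (Vec.map-cong (sumOver-scale k z) β) (Vec.map-∘ (k *_) (sumOver z) β)

  argument-sums : ∀ {n} (β : Vec FiniteSubset⁺ n) →
    Vec.map (p *_) (Vec.map (sumOver z) β) ≡ argument (Vec.map (sumOver z) β)
  argument-sums [] = refl
  argument-sums (b ∷ β) = cong₂ _∷_
    (cong (p *_) (sym (suc-pred (sumOver z b) {{>-nonZero (sumOver-positive z>0 b)}})))
    (argument-sums β)

  value∈ : ∀ {k} β → VecLinked.Linked _≺_ β →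
    fromℕ k ≡ eval f (Vec.map (p *_) (Vec.map (sumOver z) β)) → A i k
  value∈ {k} β linked eq =
    subst (λ j → A j k) (proj₂ (proj₂ (proj₂ homogeneous)) (blockSums-MT z β linked))
      (subst (A _) (sym k≡) (proj₂ (color as)))
    where
    as = Vec.map (sumOver z) β

    k≡ : k ≡ proj₁ (value as)
    k≡ = fromℕ-injective
      (trans eq (trans (cong (eval f) (argument-sums β)) (proj₂ (proj₂ (value as)))))

  MT-f : ∀ {k} → MT f (λ n → p * z n) k → A i k
  MT-f (β , linked , eq) = value∈ β linked (trans eq (cong (eval f) (map-sumOver-scale p β)))

  MT-g : ∀ {k} → MT g (λ n → q * z n) k → A i k
  MT-g (β , linked , eq) = value∈ β linked (trans eq (trans
    (cong (eval g) (map-sumOver-scale q β))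
    -- The value of `g` at the multiples by `q` is that of `f` at the multiples by `p`, so the
    -- colouring defined through `f` decides both systems.
    (eval-scale f g α g≡αf ns (Vec.map (sumOver z) β))))
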